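{- Let $G=(V,E)$ be a finite simple connected graph. For every signing $\sigma$ of $G$, encoded by $s\in\mathbb F_2^E$, and every even $\ell$, $$\operatorname{tr}\bigl(A_\sigma^\ell\bigr)=\sum_{z\in Z_{\mathrm{ev}}}N_\ell(z)\,(-1)^{s\cdot z},$$ where $N_\ell(z)\ge0$ is the number of closed walks of length $\ell$ in $G$ with parity vector $z$, independent of $\sigma$.
   Context: A signing is $\sigma\in\{\pm1\}^E$, encoded by $s\in\mathbb F_2^E$ with $\sigma_e=(-1)^{s_e}$; $A_\sigma$ is the signed adjacency matrix with $uv$ entry $\sigma_{uv}$ if $uv\in E$ and $0$ otherwise. $Z(G)\le\mathbb F_2^E$ is the cycle space, and $Z_{\mathrm{ev}}=\{z\in Z(G):|z|\text{ even}\}$, where $|z|$ is the number of nonzero coordinates. For a closed walk $w$ (with marked starting vertex and direction), its parity vector $z(w)\in\mathbb F_2^E$ has $z(w)_e$ equal to the number of traversals of $e$ by $w$ modulo $2$. -}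

module Defs where

open import Algebra.Definitions.RawMonoid using (sum)
open import Data.Bool.Base using (if_then_else_)
open import Data.Fin.Base using (Fin; _<_)
open import Data.Fin.Properties using (any?; all?; _≟_)
open import Data.Integer.Base as ℤ using (ℤ; 0ℤ; 1ℤ; _◃_)
open import Data.List.Base as List using (List; cartesianProductWith; allFin; filter; length)
open import Data.Nat.Base as ℕ using (ℕ; zero; suc; parity)
open import Data.Nat.Divisibility using (_∣_; _∣?_)
open import Data.Parity.Base as ℙ using (Parity; 0ℙ; 1ℙ; toSign)
open import Data.Parity.Properties as ℙ using ()
open import Data.Product.Base using (_×_; _,_; ∃; proj₁; proj₂)
open import Data.Product.Properties as Product using ()
open import Data.Sign.Base using (Sign)
open import Data.Sum.Base using (_⊎_)
open import Data.Vec.Base as Vec using (Vec; []; _∷_; lookup; tabulate; head; last; count)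
open import Data.Vec.Properties as Vec using ()
open import Data.Vec.Relation.Unary.Linked using (Linked; linked?)
open import Function.Definitions using (Injective)
open import Relation.Binary.Construct.Closure.ReflexiveTransitive using (Star)
open import Relation.Binary.PropositionalEquality using (_≡_)
open import Relation.Nullary using (Dec; yes; no; does; ¬?; _×-dec_; _⊎-dec_)

-- The vertices are `Fin order` and the edges are `Fin size`. An edge is a
-- two-element set of vertices, represented by its increasing pair of ends, so
-- `ends-<` excludes loops and `ends-injective` excludes parallel edges.
record SimpleGraph : Set where
  field
    order size     : ℕ
    ends           : Fin size → Fin order × Fin order
    ends-<         : ∀ e → proj₁ (ends e) < proj₂ (ends e)
    ends-injective : Injective _≡_ _≡_ ends

-- 𝔽₂ᵏ; `Parity` with its `_+_` and `_*_` is the field 𝔽₂.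
𝔽₂^_ : ℕ → Set
𝔽₂^ k = Vec Parity k

∑ℙ : ∀ {k} → (Fin k → Parity) → Parity
∑ℙ = sum ℙ.+-0-rawMonoid

_·_ : ∀ {k} → 𝔽₂^ k → 𝔽₂^ k → Parity
s · z = ∑ℙ λ e → lookup s e ℙ.* lookup z e

weight : ∀ {k} → 𝔽₂^ k → ℕ
weight = count λ p → ¬? (p ℙ.≟ 0ℙ)

signℤ : Sign → ℤ
signℤ σ = σ ◃ 1

-1^_ : Parity → ℤ
-1^ p = signℤ (toSign p)

Matrix : ℕ → Set
Matrix n = Fin n → Fin n → ℤ

∑ℤ : ∀ {k} → (Fin k → ℤ) → ℤ
∑ℤ = sum ℤ.+-0-rawMonoid

identity : ∀ {n} → Matrix n
identity u v = if does (u ≟ v) then 1ℤ else 0ℤ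

_⊗_ : ∀ {n} → Matrix n → Matrix n → Matrix n
(A ⊗ B) u w = ∑ℤ λ v → A u v ℤ.* B v w

_^ᴹ_ : ∀ {n} → Matrix n → ℕ → Matrix n
A ^ᴹ zero  = identity
A ^ᴹ suc k = A ⊗ (A ^ᴹ k)

tr : ∀ {n} → Matrix n → ℤ
tr A = ∑ℤ λ v → A v v

-- All k-tuples of elements of a list; without repetition if the list has none.
tuples : ∀ {A : Set} → List A → (k : ℕ) → List (Vec A k)
tuples xs zero    = List.[ [] ]
tuples xs (suc k) = cartesianProductWith _∷_ xs (tuples xs k)

sumOver : ∀ {A : Set} → List A → (A → ℤ) → ℤ
sumOver xs f = List.foldr ℤ._+_ 0ℤ (List.map f xs)

module _ (G : SimpleGraph) where
  open SimpleGraph G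

  Joins : Fin size → Fin order → Fin order → Set
  Joins e u v = ends e ≡ (u , v) ⊎ ends e ≡ (v , u)

  joins? : ∀ e u v → Dec (Joins e u v)
  joins? e u v = Product.≡-dec _≟_ _≟_ (ends e) (u , v)
           ⊎-dec Product.≡-dec _≟_ _≟_ (ends e) (v , u)

  Adjacent : Fin order → Fin order → Set
  Adjacent u v = ∃ λ e → Joins e u v

  adjacent? : ∀ u v → Dec (Adjacent u v)
  adjacent? u v = any? λ e → joins? e u v

  Incident : Fin size → Fin order → Set
  Incident e v = v ≡ proj₁ (ends e) ⊎ v ≡ proj₂ (ends e)

  incident? : ∀ e v → Dec (Incident e v)
  incident? e v = (v ≟ proj₁ (ends e)) ⊎-dec (v ≟ proj₂ (ends e))

  Connected : Set
  Connected = ∀ u v → Star Adjacent u v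

  Signing : Set
  Signing = Vec Sign size

  Encodes : 𝔽₂^ size → Signing → Set
  Encodes s σ = ∀ e → lookup σ e ≡ toSign (lookup s e)

  -- The edge found by `adjacent?` is the only one joining u and v.
  signedAdjacency : Signing → Matrix order
  signedAdjacency σ u v with adjacent? u v
  ... | yes (e , _) = signℤ (lookup σ e)
  ... | no  _       = 0ℤ

  -- The cycle space is the kernel of the boundary map 𝔽₂^E → 𝔽₂^V.
  boundary : 𝔽₂^ size → Fin order → Parity
  boundary z v = ∑ℙ λ e → if does (incident? e v) then lookup z e else 0ℙ

  InCycleSpace : 𝔽₂^ size → Set
  InCycleSpace z = ∀ v → boundary z v ≡ 0ℙ

  inCycleSpace? : ∀ z → Dec (InCycleSpace z)
  inCycleSpace? z = all? λ v → boundary z v ℙ.≟ 0ℙ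

  InZ-ev : 𝔽₂^ size → Set
  InZ-ev z = InCycleSpace z × 2 ∣ weight z

  inZ-ev? : ∀ z → Dec (InZ-ev z)
  inZ-ev? z = inCycleSpace? z ×-dec (2 ∣? weight z)

  Z-ev : List (𝔽₂^ size)
  Z-ev = filter inZ-ev? (tuples (0ℙ List.∷ 1ℙ List.∷ List.[]) size)

  -- A closed walk of length ℓ is its vertex sequence v₀, …, v_ℓ = v₀, which
  -- records the starting vertex and the direction.
  IsClosedWalk : ∀ {ℓ} → Vec (Fin order) (suc ℓ) → Set
  IsClosedWalk w = Linked Adjacent w × head w ≡ last w

  isClosedWalk? : ∀ {ℓ} (w : Vec (Fin order) (suc ℓ)) → Dec (IsClosedWalk w)
  isClosedWalk? w = linked? adjacent? w ×-dec (head w ≟ last w)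

  traversals : ∀ {ℓ} → Fin size → Vec (Fin order) (suc ℓ) → ℕ
  traversals e (u ∷ [])    = 0
  traversals e (u ∷ v ∷ w) = (if does (joins? e u v) then 1 else 0) ℕ.+ traversals e (v ∷ w)

  parityVector : ∀ {ℓ} → Vec (Fin order) (suc ℓ) → 𝔽₂^ size
  parityVector w = tabulate λ e → parity (traversals e w)

  N : ℕ → 𝔽₂^ size → ℕ
  N ℓ z = length (filter (λ w → isClosedWalk? w ×-dec Vec.≡-dec ℙ._≟_ (parityVector w) z)
                         (tuples (allFin order) (suc ℓ)))

{-# OPTIONS --safe #-}

-- Expanding the trace writes it as a sum, over the closed sequences of vertices,
-- of products of entries of A_σ; such a product vanishes unless the sequence is a
-- walk w, and then it is (-1)^(s · z(w)). It remains to group the closed walks by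
-- z(w), which lies in Z_ev. Pairing z(w) with any c ∈ 𝔽₂^E adds up c along the
-- steps of w: c = s gives the sign of w, the incidence vector of a vertex gives the
-- boundary of z(w), and the all-ones vector gives the parity of |z(w)|.
module Submission where

open import Defs
open import Data.Integer.Base using (+_; _*_)
open import Data.Nat.Base using (ℕ)
open import Data.Nat.Divisibility using (_∣_)
open import Relation.Binary.PropositionalEquality using (_≡_)

open import Algebra.Properties.Semiring.Sum as SemiringSum using ()
open import Data.Bool.Base using (Bool; true; false; if_then_else_; _∧_; _∨_)
open import Data.Bool.Properties using (if-cong)
open import Data.Fin.Base using (Fin; zero; suc; punchIn)
open import Data.Fin.Properties using (_≟_; <-asym; <-irrefl; punchInᵢ≢i)
open import Data.Integer.Base as ℤ using (ℤ; 0ℤ; 1ℤ)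
open import Data.Integer.Properties as ℤ using (+-commutativeSemigroup)
open import Algebra.Properties.CommutativeSemigroup +-commutativeSemigroup
  using (interchange)
open import Data.List.Base
  using (List; []; _∷_; _++_; map; tabulate; allFin; filter; length; cartesianProductWith)
open import Data.List.Properties using (map-tabulate)
open import Data.Nat.Base as ℕ using (zero; suc; parity)
open import Data.Nat.Divisibility using (divides; ∣-refl; ∣m∣n⇒∣m+n; _∣0)
open import Data.Parity.Base as ℙ using (Parity; 0ℙ; 1ℙ)
open import Data.Parity.Properties as ℙ using (p+p≡0ℙ)
open import Data.Product.Base using (_,_; proj₁; proj₂)
open import Data.Sum.Base using (inj₁; inj₂)
open import Data.Vec.Base as Vec using (Vec; []; _∷_; lookup; head; last)
open import Data.Vec.Properties as Vec using (lookup∘tabulate)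
open import Data.Vec.Relation.Unary.Linked using (Linked; [-]; _∷_; linked?)
open import Function.Base using (_∘_)
open import Relation.Binary.PropositionalEquality
  using (_≢_; refl; sym; trans; cong; cong₂; ≢-sym; module ≡-Reasoning)
open import Relation.Nullary using (Dec; yes; no; does; contradiction)
open import Relation.Nullary.Decidable using (dec-true; dec-false; does-≡; map′)
open import Relation.Unary using (Decidable)

open SemiringSum ℙ.+-*-semiring
  using (sum-cong-≗; sum-remove; sum-replicate-zero; ∑-distrib-+)

open ≡-Reasoning

private
  variable
    A B C : Set
    k n : ℕ

-- Integer sums over lists, restricted by Boolean tests

infixl 5 _when_

-- Restriction is by a Boolean rather than by a decision: `does` of a product decision reduces to
-- `_∧_`, so tests can be merged and reordered without handling their proofs.
_when_ : ℤ → Bool → ℤ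
x when b = if b then x else 0ℤ

when-∧ : ∀ x b c → x when b when c ≡ x when b ∧ c
when-∧ x true  c     = refl
when-∧ x false true  = refl
when-∧ x false false = refl

when-comm : ∀ x b c → x when b when c ≡ x when c when b
when-comm x true  true  = refl
when-comm x true  false = refl
when-comm x false true  = refl
when-comm x false false = refl

*-when : ∀ x y b → x * (y when b) ≡ x * y when b
*-when x y true  = refl
*-when x y false = ℤ.*-zeroʳ x

sumOver-cong : ∀ (xs : List A) {f g : A → ℤ} → (∀ x → f x ≡ g x) →
               sumOver xs f ≡ sumOver xs g
sumOver-cong []       f≗g = refl
sumOver-cong (x ∷ xs) f≗g = cong₂ ℤ._+_ (f≗g x) (sumOver-cong xs f≗g)

sumOver-0 : ∀ (xs : List A) → sumOver xs (λ _ → 0ℤ) ≡ 0ℤ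
sumOver-0 []       = refl
sumOver-0 (x ∷ xs) = trans (ℤ.+-identityˡ _) (sumOver-0 xs)

sumOver-+ : ∀ (xs : List A) (f g : A → ℤ) →
            sumOver xs (λ x → f x ℤ.+ g x) ≡ sumOver xs f ℤ.+ sumOver xs g
sumOver-+ []       f g = refl
sumOver-+ (x ∷ xs) f g =
  trans (cong (λ t → f x ℤ.+ g x ℤ.+ t) (sumOver-+ xs f g)) (interchange (f x) (g x) _ _)

sumOver-comm : ∀ (xs : List A) (ys : List B) (f : A → B → ℤ) →
               sumOver xs (λ x → sumOver ys (f x)) ≡
               sumOver ys (λ y → sumOver xs (λ x → f x y))
sumOver-comm []       ys f = sym (sumOver-0 ys)
sumOver-comm (x ∷ xs) ys f =
  trans (cong (ℤ._+_ (sumOver ys (f x))) (sumOver-comm xs ys f)) (sym (sumOver-+ ys (f x) _))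

*-distribˡ-sumOver : ∀ c (xs : List A) (f : A → ℤ) →
                     c * sumOver xs f ≡ sumOver xs (λ x → c * f x)
*-distribˡ-sumOver c []       f = ℤ.*-zeroʳ c
*-distribˡ-sumOver c (x ∷ xs) f =
  trans (ℤ.*-distribˡ-+ c (f x) _) (cong (ℤ._+_ (c * f x)) (*-distribˡ-sumOver c xs f))

sumOver-when : ∀ (xs : List A) (f : A → ℤ) b →
               sumOver xs (λ x → f x when b) ≡ sumOver xs f when b
sumOver-when xs f true  = refl
sumOver-when xs f false = sumOver-0 xs

sumOver-++ : ∀ (xs ys : List A) (f : A → ℤ) →
             sumOver (xs ++ ys) f ≡ sumOver xs f ℤ.+ sumOver ys f
sumOver-++ []       ys f = sym (ℤ.+-identityˡ _)
sumOver-++ (x ∷ xs) ys f =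
  trans (cong (ℤ._+_ (f x)) (sumOver-++ xs ys f)) (sym (ℤ.+-assoc (f x) _ _))

sumOver-map : ∀ (g : A → B) (xs : List A) (f : B → ℤ) →
              sumOver (map g xs) f ≡ sumOver xs (f ∘ g)
sumOver-map g []       f = refl
sumOver-map g (x ∷ xs) f = cong (ℤ._+_ (f (g x))) (sumOver-map g xs f)

sumOver-cartesianProductWith :
  ∀ (g : A → B → C) (xs : List A) (ys : List B) (f : C → ℤ) →
  sumOver (cartesianProductWith g xs ys) f ≡ sumOver xs (λ x → sumOver ys (λ y → f (g x y)))
sumOver-cartesianProductWith g []       ys f = refl
sumOver-cartesianProductWith g (x ∷ xs) ys f =
  trans (sumOver-++ (map (g x) ys) _ f)
        (cong₂ ℤ._+_ (sumOver-map (g x) ys f) (sumOver-cartesianProductWith g xs ys f))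

sumOver-filter : ∀ {P : A → Set} (P? : Decidable P) (xs : List A) (f : A → ℤ) →
                 sumOver (filter P? xs) f ≡ sumOver xs (λ x → f x when does (P? x))
sumOver-filter P? []       f = refl
sumOver-filter P? (x ∷ xs) f with does (P? x)
... | false = trans (sumOver-filter P? xs f) (sym (ℤ.+-identityˡ _))
... | true  = cong (ℤ._+_ (f x)) (sumOver-filter P? xs f)

sumOver-const : ∀ (xs : List A) c → sumOver xs (λ _ → c) ≡ + length xs * c
sumOver-const []       c = refl
sumOver-const (x ∷ xs) c =
  trans (cong (ℤ._+_ c) (sumOver-const xs c)) (sym (ℤ.suc-* (+ length xs) c))

-- Turns a count times a sign into a sum over all candidates, the form in which the count `N` can
-- take part in an exchange of two sums.
length-filter-* : ∀ {P : A → Set} (P? : Decidable P) (xs : List A) c →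
                  + length (filter P? xs) * c ≡ sumOver xs (λ x → c when does (P? x))
length-filter-* P? xs c =
  trans (sym (sumOver-const (filter P? xs) c)) (sumOver-filter P? xs (λ _ → c))

∑ℤ-allFin : ∀ (f : Fin n → ℤ) → ∑ℤ f ≡ sumOver (allFin n) f
∑ℤ-allFin {zero}  f = refl
∑ℤ-allFin {suc n} f = cong (ℤ._+_ (f zero)) (begin
  ∑ℤ (f ∘ suc)                               ≡⟨ ∑ℤ-allFin (f ∘ suc) ⟩
  sumOver (allFin n) (f ∘ suc)               ≡⟨ sumOver-map suc (allFin n) f ⟨
  sumOver (map suc (allFin n)) f             ≡⟨ cong (λ xs → sumOver xs f) (map-tabulate (λ i → i) suc) ⟩
  sumOver (tabulate suc) f    ∎)

-- Evaluation at a point of 𝔽₂ᵏ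

parities : List Parity
parities = 0ℙ ∷ 1ℙ ∷ []

sumOver-parities-point : ∀ p (f : Parity → ℤ) →
                         sumOver parities (λ q → f q when does (p ℙ.≟ q)) ≡ f p
sumOver-parities-point 0ℙ f = ℤ.+-identityʳ (f 0ℙ)
sumOver-parities-point 1ℙ f = trans (ℤ.+-identityˡ _) (ℤ.+-identityʳ (f 1ℙ))

-- Each parity is listed once in `parities`, so exactly one tuple equals `p`. In the induction,
-- equality of vectors splits into a head test and a tail test; the head test is constant in the
-- inner sum and is moved out of it.
sumOver-𝔽₂^-point : ∀ (p : 𝔽₂^ k) (f : 𝔽₂^ k → ℤ) →
  sumOver (tuples parities k) (λ z → f z when does (Vec.≡-dec ℙ._≟_ p z)) ≡ f p
sumOver-𝔽₂^-point         []      f = ℤ.+-identityʳ (f [])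
sumOver-𝔽₂^-point {suc k} (p ∷ ps) f = begin
  sumOver (tuples parities (suc k)) (λ z → f z when does (Vec.≡-dec ℙ._≟_ (p ∷ ps) z))
    ≡⟨ sumOver-cartesianProductWith _∷_ parities T _ ⟩
  sumOver parities (λ q → sumOver T λ z → f (q ∷ z) when p≟ q ∧ ps≟ z)
    ≡⟨ sumOver-cong parities (λ q → begin
         sumOver T (λ z → f (q ∷ z) when p≟ q ∧ ps≟ z)
           ≡⟨ sumOver-cong T (λ z → trans (sym (when-∧ (f (q ∷ z)) (p≟ q) (ps≟ z)))
                                          (when-comm (f (q ∷ z)) (p≟ q) (ps≟ z))) ⟩
         sumOver T (λ z → f (q ∷ z) when ps≟ z when p≟ q)
           ≡⟨ sumOver-when T (λ z → f (q ∷ z) when ps≟ z) (p≟ q) ⟩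
         sumOver T (λ z → f (q ∷ z) when ps≟ z) when p≟ q
           ≡⟨ cong (_when p≟ q) (sumOver-𝔽₂^-point ps (λ z → f (q ∷ z))) ⟩
         f (q ∷ ps) when p≟ q ∎) ⟩
  sumOver parities (λ q → f (q ∷ ps) when p≟ q)
    ≡⟨ sumOver-parities-point p (λ q → f (q ∷ ps)) ⟩
  f (p ∷ ps) ∎
  where
  T = tuples parities k

  p≟ : Parity → Bool
  p≟ q = does (p ℙ.≟ q)

  ps≟ : 𝔽₂^ k → Bool
  ps≟ z = does (Vec.≡-dec ℙ._≟_ ps z)

-- Signs, parities and sums in 𝔽₂

-1^-homo : ∀ p q → -1^ (p ℙ.+ q) ≡ -1^ p * -1^ q
-1^-homo 0ℙ 0ℙ = refl
-1^-homo 0ℙ 1ℙ = refl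
-1^-homo 1ℙ 0ℙ = refl
-1^-homo 1ℙ 1ℙ = refl

2∣⇒parity≡0ℙ : 2 ∣ n → parity n ≡ 0ℙ
2∣⇒parity≡0ℙ (divides q refl) = trans (ℙ.*-homo-* q 2) (ℙ.*-zeroʳ (parity q))

parity≡0ℙ⇒2∣ : ∀ n → parity n ≡ 0ℙ → 2 ∣ n
parity≡0ℙ⇒2∣ zero          _  = 2 ∣0
-- The case `n = 1` is absurd because `parity 1` computes to `1ℙ`; here `parity` computes past the
-- two successors, so `eq` already concerns `n`.
parity≡0ℙ⇒2∣ (suc (suc n)) eq = ∣m∣n⇒∣m+n ∣-refl (parity≡0ℙ⇒2∣ n eq)

bit : Bool → Parity
bit b = if b then 1ℙ else 0ℙ

-- Over 𝔽₂ a sum of two indicators is the indicator of the exclusive disjunction; `u ≢ v` rules out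
-- that both hold.
bit-∨ : ∀ (x : Fin n) {u v} → u ≢ v →
        bit (does (x ≟ u) ∨ does (x ≟ v)) ≡ bit (does (x ≟ u)) ℙ.+ bit (does (x ≟ v))
bit-∨ x {u} {v} u≢v with x ≟ u | x ≟ v
... | yes refl | yes refl = contradiction refl u≢v
... | yes _    | no _     = refl
... | no _     | yes _    = refl
... | no _     | no _     = refl

∑ℙ-point : ∀ (f : Fin n → Parity) i → (∀ j → j ≢ i → f j ≡ 0ℙ) → ∑ℙ f ≡ f i
∑ℙ-point {suc n} f i f≡0 = begin
  ∑ℙ f
    ≡⟨ sum-remove {i = i} f ⟩
  f i ℙ.+ ∑ℙ (λ j → f (punchIn i j))
    ≡⟨ cong (f i ℙ.+_) (sum-cong-≗ (λ j → f≡0 _ (punchInᵢ≢i i j))) ⟩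
  f i ℙ.+ ∑ℙ {n} (λ _ → 0ℙ)
    ≡⟨ cong (f i ℙ.+_) (sum-replicate-zero n) ⟩
  f i ℙ.+ 0ℙ
    ≡⟨ ℙ.+-identityʳ (f i) ⟩
  f i ∎

∑ℙ-0 : ∀ (c : Fin n → Parity) → ∑ℙ (λ i → c i ℙ.* 0ℙ) ≡ 0ℙ
∑ℙ-0 {n} c = trans (sum-cong-≗ (λ i → ℙ.*-zeroʳ (c i))) (sum-replicate-zero n)

-- An element of 𝔽₂ is its own indicator of being nonzero, so counting the nonzero entries modulo 2
-- adds up the entries.
parity-weight : ∀ (z : 𝔽₂^ k) → parity (weight z) ≡ ∑ℙ (lookup z)
parity-weight []       = refl
parity-weight (0ℙ ∷ z) = parity-weight z
parity-weight (1ℙ ∷ z) = trans (ℙ.+-homo-+ 1 (weight z)) (cong (1ℙ ℙ.+_) (parity-weight z))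

-- Matrix powers and traces as sums over vertex sequences

walkProduct : Matrix n → Vec (Fin n) (suc k) → ℤ
walkProduct M (u ∷ [])    = 1ℤ
walkProduct M (u ∷ v ∷ w) = M u v * walkProduct M (v ∷ w)

-- The tuple `w` holds the `k` vertices after `u`. All sequences are summed, walks or not, and the
-- end vertex is fixed by a test. Its orientation `v ≟ last` becomes `head w ≟ last w` on the
-- diagonal, as in `isClosedWalk?`.
power-expansion : ∀ (M : Matrix n) k u v →
  (M ^ᴹ k) u v ≡
  sumOver (tuples (allFin n) k) (λ w → walkProduct M (u ∷ w) when does (v ≟ last (u ∷ w)))
power-expansion M zero u v =
  -- The only sequence is `u` itself. `identity` tests `u ≟ v` while the sum tests `v ≟ u`, hence
  -- the symmetry.
  trans (if-cong (does-≡ (u ≟ v) (map′ sym sym (v ≟ u))))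
        (sym (ℤ.+-identityʳ _))
power-expansion {n} M (suc k) u v = begin
  ∑ℤ (λ x → M u x * (M ^ᴹ k) x v)
    ≡⟨ ∑ℤ-allFin {n} _ ⟩
  sumOver (allFin n) (λ x → M u x * (M ^ᴹ k) x v)
    ≡⟨ sumOver-cong (allFin n) (λ x → begin
         M u x * (M ^ᴹ k) x v
           ≡⟨ cong (M u x *_) (power-expansion M k x v) ⟩
         M u x * sumOver T (λ w → walkProduct M (x ∷ w) when does (v ≟ last (x ∷ w)))
           ≡⟨ *-distribˡ-sumOver (M u x) T _ ⟩
         sumOver T (λ w → M u x * (walkProduct M (x ∷ w) when does (v ≟ last (x ∷ w))))
           ≡⟨ sumOver-cong T (λ w → *-when (M u x) (walkProduct M (x ∷ w)) _) ⟩
         sumOver T (λ w → walkProduct M (u ∷ x ∷ w) when does (v ≟ last (u ∷ x ∷ w))) ∎) ⟩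
  sumOver (allFin n) (λ x → sumOver T (λ w →
    walkProduct M (u ∷ x ∷ w) when does (v ≟ last (u ∷ x ∷ w))))
    ≡⟨ sumOver-cartesianProductWith _∷_ (allFin n) T _ ⟨
  sumOver (tuples (allFin n) (suc k)) (λ w →
    walkProduct M (u ∷ w) when does (v ≟ last (u ∷ w))) ∎
  where T = tuples (allFin n) k

trace-expansion : ∀ (M : Matrix n) k →
  tr (M ^ᴹ k) ≡
  sumOver (tuples (allFin n) (suc k)) (λ w → walkProduct M w when does (head w ≟ last w))
trace-expansion {n} M k = begin
  ∑ℤ (λ u → (M ^ᴹ k) u u)
    ≡⟨ ∑ℤ-allFin {n} _ ⟩
  sumOver (allFin n) (λ u → (M ^ᴹ k) u u)
    ≡⟨ sumOver-cong (allFin n) (λ u → power-expansion M k u u) ⟩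
  sumOver (allFin n) (λ u → sumOver (tuples (allFin n) k) λ w →
    walkProduct M (u ∷ w) when does (u ≟ last (u ∷ w)))
    ≡⟨ sumOver-cartesianProductWith _∷_ (allFin n) (tuples (allFin n) k) _ ⟨
  sumOver (tuples (allFin n) (suc k)) (λ w → walkProduct M w when does (head w ≟ last w)) ∎

-- Walks in a graph and their parity vectors

module _ (G : SimpleGraph) where
  open SimpleGraph G

  Joins⇒≢ : ∀ {e u v} → Joins G e u v → u ≢ v
  Joins⇒≢ {e} (inj₁ eq) refl = <-irrefl (trans (cong proj₁ eq) (sym (cong proj₂ eq))) (ends-< e)
  Joins⇒≢ {e} (inj₂ eq) refl = <-irrefl (trans (cong proj₁ eq) (sym (cong proj₂ eq))) (ends-< e)

  ends-not-opposite : ∀ {e e′ u v} → ends e ≡ (u , v) → ends e′ ≢ (v , u)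
  ends-not-opposite {e} {e′} eq eq′ with ends e | ends e′ | ends-< e | ends-< e′
  ends-not-opposite refl refl | _ | _ | u<v | v<u = <-asym u<v v<u

  -- Equally ordered ends give equal edges by `ends-injective`; opposite orders would give both
  -- `u < v` and `v < u`. Hence a step of a walk traverses exactly one edge.
  Joins-unique : ∀ {e e′ u v} → Joins G e u v → Joins G e′ u v → e ≡ e′
  Joins-unique (inj₁ eq) (inj₁ eq′) = ends-injective (trans eq (sym eq′))
  Joins-unique (inj₁ eq) (inj₂ eq′) = contradiction eq′ (ends-not-opposite eq)
  Joins-unique (inj₂ eq) (inj₁ eq′) = contradiction eq (ends-not-opposite eq′)
  Joins-unique (inj₂ eq) (inj₂ eq′) = ends-injective (trans eq (sym eq′))

  -- The dot product of `c` with the parity vector of `w`, written through `traversals` so that it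
  -- can be unfolded one step of `w` at a time.
  pairing : (Fin size → Parity) → Vec (Fin order) (suc k) → Parity
  pairing c w = ∑ℙ λ e → c e ℙ.* parity (traversals G e w)

  -- Traversal counts add modulo 2 and the coefficients distribute over them; in the sum for the
  -- first step only the edge `e` has a nonzero count.
  pairing-step : ∀ c {e u v} → Joins G e u v → (w : Vec (Fin order) k) →
                 pairing c (u ∷ v ∷ w) ≡ c e ℙ.+ pairing c (v ∷ w)
  pairing-step c {e} {u} {v} j w = begin
    ∑ℙ (λ i → c i ℙ.* parity (step i ℕ.+ traversals G i (v ∷ w)))
      ≡⟨ sum-cong-≗ (λ i → trans
           (cong (c i ℙ.*_) (ℙ.+-homo-+ (step i) (traversals G i (v ∷ w))))
           (ℙ.*-distribˡ-+ (c i) _ _)) ⟩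
    ∑ℙ (λ i → (c i ℙ.* parity (step i)) ℙ.+ (c i ℙ.* parity (traversals G i (v ∷ w))))
      ≡⟨ ∑-distrib-+ (λ i → c i ℙ.* parity (step i))
                      (λ i → c i ℙ.* parity (traversals G i (v ∷ w))) ⟩
    ∑ℙ (λ i → c i ℙ.* parity (step i)) ℙ.+ pairing c (v ∷ w)
      ≡⟨ cong (ℙ._+ pairing c (v ∷ w)) (∑ℙ-point _ e off-edge) ⟩
    (c e ℙ.* parity (step e)) ℙ.+ pairing c (v ∷ w)
      ≡⟨ cong (λ b → (c e ℙ.* parity (if b then 1 else 0)) ℙ.+ pairing c (v ∷ w))
              (dec-true (joins? G e u v) j) ⟩
    (c e ℙ.* 1ℙ) ℙ.+ pairing c (v ∷ w)
      ≡⟨ cong (ℙ._+ pairing c (v ∷ w)) (ℙ.*-identityʳ (c e)) ⟩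
    c e ℙ.+ pairing c (v ∷ w) ∎
    where
    step : Fin size → ℕ
    step i = if does (joins? G i u v) then 1 else 0

    off-edge : ∀ i → i ≢ e → c i ℙ.* parity (step i) ≡ 0ℙ
    off-edge i i≢e = trans
      (cong (λ b → c i ℙ.* parity (if b then 1 else 0))
            (dec-false (joins? G i u v) (λ j′ → i≢e (Joins-unique j′ j))))
      (ℙ.*-zeroʳ (c i))

  ·-parityVector : ∀ s (w : Vec (Fin order) (suc k)) →
                   s · parityVector G w ≡ pairing (lookup s) w
  ·-parityVector s w = sum-cong-≗ λ e →
    cong (lookup s e ℙ.*_) (lookup∘tabulate (λ i → parity (traversals G i w)) e)

  boundary-parityVector : ∀ (w : Vec (Fin order) (suc k)) x →
    boundary G (parityVector G w) x ≡ pairing (λ e → bit (does (incident? G e x))) w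
  boundary-parityVector w x = sum-cong-≗ λ e → trans
    (cong (if does (incident? G e x) then_else 0ℙ)
          (lookup∘tabulate (λ i → parity (traversals G i w)) e))
    (if≡bit* (does (incident? G e x)) _)
    where
    if≡bit* : ∀ b p → (if b then p else 0ℙ) ≡ bit b ℙ.* p
    if≡bit* true  p = refl
    if≡bit* false p = refl

  parity-weight-parityVector : ∀ (w : Vec (Fin order) (suc k)) →
    parity (weight (parityVector G w)) ≡ pairing (λ _ → 1ℙ) w
  parity-weight-parityVector w = trans (parity-weight (parityVector G w))
    (sum-cong-≗ (lookup∘tabulate (λ i → parity (traversals G i w))))

  pairing-1 : ∀ {w : Vec (Fin order) (suc k)} → Linked (Adjacent G) w →
              pairing (λ _ → 1ℙ) w ≡ parity k
  pairing-1 [-] = ∑ℙ-0 (λ (_ : Fin size) → 1ℙ)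
  pairing-1 {suc k} {u ∷ v ∷ w} ((e , j) ∷ l) = begin
    pairing (λ _ → 1ℙ) (u ∷ v ∷ w)    ≡⟨ pairing-step (λ _ → 1ℙ) j w ⟩
    1ℙ ℙ.+ pairing (λ _ → 1ℙ) (v ∷ w) ≡⟨ cong (1ℙ ℙ.+_) (pairing-1 l) ⟩
    1ℙ ℙ.+ parity k                   ≡⟨ ℙ.+-homo-+ 1 k ⟨
    parity (suc k)                    ∎

  -- The ends of an edge are distinct, so its incidence indicator is the sum of the indicators of
  -- its two ends. If the ends are stored as `(v , u)`, the sum comes out in the other order.
  incident-Joins : ∀ {e u v} → Joins G e u v → ∀ x →
    bit (does (incident? G e x)) ≡ bit (does (x ≟ u)) ℙ.+ bit (does (x ≟ v))
  incident-Joins j@(inj₁ eq) x = trans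
    (cong (λ p → bit (does (x ≟ proj₁ p) ∨ does (x ≟ proj₂ p))) eq)
    (bit-∨ x (Joins⇒≢ j))
  incident-Joins {v = v} j@(inj₂ eq) x = trans
    (cong (λ p → bit (does (x ≟ proj₁ p) ∨ does (x ≟ proj₂ p))) eq)
    (trans (bit-∨ x (≢-sym (Joins⇒≢ j))) (ℙ.+-comm (bit (does (x ≟ v))) _))

  -- A telescoping sum modulo 2: every intermediate position of the walk is counted by the step into
  -- it and by the step out of it, which cancel, and only the two extreme positions survive.
  pairing-incident : ∀ {w : Vec (Fin order) (suc k)} → Linked (Adjacent G) w → ∀ x →
    pairing (λ e → bit (does (incident? G e x))) w ≡
    bit (does (x ≟ head w)) ℙ.+ bit (does (x ≟ last w))
  pairing-incident {w = u ∷ []} [-] x =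
    trans (∑ℙ-0 (λ e → bit (does (incident? G e x)))) (sym (p+p≡0ℙ (bit (does (x ≟ u)))))
  pairing-incident {w = u ∷ v ∷ w} ((e , j) ∷ l) x = begin
    pairing c (u ∷ v ∷ w)                         ≡⟨ pairing-step c j w ⟩
    c e ℙ.+ pairing c (v ∷ w)                     ≡⟨ cong₂ ℙ._+_ (incident-Joins j x) (pairing-incident l x) ⟩
    (δ u ℙ.+ δ v) ℙ.+ (δ v ℙ.+ δ (last (v ∷ w)))  ≡⟨ cancel (δ u) (δ v) _ ⟩
    δ u ℙ.+ δ (last (v ∷ w))                      ∎
    where
    c : Fin size → Parity
    c e = bit (does (incident? G e x))

    δ : Fin order → Parity
    δ y = bit (does (x ≟ y))

    cancel : ∀ p q r → (p ℙ.+ q) ℙ.+ (q ℙ.+ r) ≡ p ℙ.+ r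
    cancel p q r = begin
      (p ℙ.+ q) ℙ.+ (q ℙ.+ r) ≡⟨ ℙ.+-assoc p q (q ℙ.+ r) ⟩
      p ℙ.+ (q ℙ.+ (q ℙ.+ r)) ≡⟨ cong (p ℙ.+_) (ℙ.+-assoc q q r) ⟨
      p ℙ.+ ((q ℙ.+ q) ℙ.+ r) ≡⟨ cong (λ t → p ℙ.+ (t ℙ.+ r)) (p+p≡0ℙ q) ⟩
      p ℙ.+ r                 ∎

  parityVector∈Z-ev : 2 ∣ k → ∀ (w : Vec (Fin order) (suc k)) → IsClosedWalk G w →
                      InZ-ev G (parityVector G w)
  parityVector∈Z-ev {k} 2∣k w (l , closed) = inCycleSpace , parity≡0ℙ⇒2∣ _ (begin
    parity (weight (parityVector G w))  ≡⟨ parity-weight-parityVector w ⟩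
    pairing (λ _ → 1ℙ) w                ≡⟨ pairing-1 l ⟩
    parity k                            ≡⟨ 2∣⇒parity≡0ℙ 2∣k ⟩
    0ℙ                                  ∎)
    where
    inCycleSpace : InCycleSpace G (parityVector G w)
    inCycleSpace x = begin
      boundary G (parityVector G w) x
        ≡⟨ boundary-parityVector w x ⟩
      pairing (λ e → bit (does (incident? G e x))) w
        ≡⟨ pairing-incident l x ⟩
      bit (does (x ≟ head w)) ℙ.+ bit (does (x ≟ last w))
        -- Closedness makes the two surviving indicators equal, so they cancel over 𝔽₂.
        ≡⟨ cong (λ y → bit (does (x ≟ head w)) ℙ.+ bit (does (x ≟ y))) closed ⟨
      bit (does (x ≟ head w)) ℙ.+ bit (does (x ≟ head w))
        ≡⟨ p+p≡0ℙ (bit (does (x ≟ head w))) ⟩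
      0ℙ ∎

  -- Signs of walks, and grouping by parity vector

  walkProduct-signedAdjacency :
    ∀ σ s → Encodes G s σ → ∀ (w : Vec (Fin order) (suc k)) →
    walkProduct (signedAdjacency G σ) w ≡
    -1^ pairing (lookup s) w when does (linked? (adjacent? G) w)
  walkProduct-signedAdjacency σ s enc (u ∷ []) =
    cong -1^_ (sym (∑ℙ-0 (lookup s)))
  walkProduct-signedAdjacency σ s enc (u ∷ v ∷ w) with adjacent? G u v
  -- The entry is `0ℤ` and annihilates the product, while the test for `Linked` computes to `false`.
  ... | no _        = refl
  ... | yes (e , j) = begin
    signℤ (lookup σ e) * walkProduct (signedAdjacency G σ) (v ∷ w)
      ≡⟨ cong₂ _*_ (cong signℤ (enc e)) (walkProduct-signedAdjacency σ s enc (v ∷ w)) ⟩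
    -1^ lookup s e * (-1^ pairing (lookup s) (v ∷ w) when linked)
      ≡⟨ *-when (-1^ lookup s e) _ linked ⟩
    -1^ lookup s e * -1^ pairing (lookup s) (v ∷ w) when linked
      ≡⟨ cong (_when linked) (-1^-homo (lookup s e) _) ⟨
    -1^ (lookup s e ℙ.+ pairing (lookup s) (v ∷ w)) when linked
      -- The edge returned by `adjacent?`, whose sign is the matrix entry, serves as the edge of the
      -- step.
      ≡⟨ cong (λ p → -1^ p when linked) (pairing-step (lookup s) j w) ⟨
    -1^ pairing (lookup s) (u ∷ v ∷ w) when linked ∎
    where linked = does (linked? (adjacent? G) (v ∷ w))

  -- A closed walk belongs to exactly one class, that of its parity vector. The decision `closed?`
  -- is an argument so that matching on it reduces the Boolean on both sides at once.
  sumOver-Z-ev-point :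
    2 ∣ k → ∀ (w : Vec (Fin order) (suc k)) (closed? : Dec (IsClosedWalk G w))
    (f : 𝔽₂^ size → ℤ) →
    sumOver (Z-ev G) (λ z →
      f z when does closed? ∧ does (Vec.≡-dec ℙ._≟_ (parityVector G w) z)) ≡
    f (parityVector G w) when does closed?
  sumOver-Z-ev-point 2∣k w (no _)       f = sumOver-0 (Z-ev G)
  sumOver-Z-ev-point 2∣k w (yes closed) f = begin
    sumOver (Z-ev G) (λ z → f z when does (pv≟ z))
      ≡⟨ sumOver-filter (inZ-ev? G) 𝔽 _ ⟩
    sumOver 𝔽 (λ z → f z when does (pv≟ z) when does (inZ-ev? G z))
      -- With the equality test outermost, membership in `Z-ev` becomes part of the function
      -- evaluated at the point, where it holds by the evenness of the length.
      ≡⟨ sumOver-cong 𝔽 (λ z → when-comm (f z) (does (pv≟ z)) _) ⟩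
    sumOver 𝔽 (λ z → f z when does (inZ-ev? G z) when does (pv≟ z))
      ≡⟨ sumOver-𝔽₂^-point (parityVector G w) _ ⟩
    f (parityVector G w) when does (inZ-ev? G (parityVector G w))
      ≡⟨ if-cong (dec-true (inZ-ev? G (parityVector G w)) (parityVector∈Z-ev 2∣k w closed)) ⟩
    f (parityVector G w) ∎
    where
    𝔽 = tuples parities size
    pv≟ = Vec.≡-dec ℙ._≟_ (parityVector G w)

lemma1 : (G : SimpleGraph) → Connected G →
    (σ : Signing G) (s : 𝔽₂^ (SimpleGraph.size G)) → Encodes G s σ →
    (ℓ : ℕ) → 2 ∣ ℓ →
    tr (signedAdjacency G σ ^ᴹ ℓ) ≡ sumOver (Z-ev G) (λ z → + (N G ℓ z) * (-1^ (s · z)))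
lemma1 G _ σ s enc ℓ 2∣ℓ = begin
  tr (signedAdjacency G σ ^ᴹ ℓ)
    ≡⟨ trace-expansion (signedAdjacency G σ) ℓ ⟩
  sumOver walks (λ w → walkProduct (signedAdjacency G σ) w when does (head w ≟ last w))
    ≡⟨ sumOver-cong walks (λ w → begin
         walkProduct (signedAdjacency G σ) w when does (head w ≟ last w)
           ≡⟨ cong (_when does (head w ≟ last w)) (walkProduct-signedAdjacency G σ s enc w) ⟩
         -1^ pairing G (lookup s) w when does (linked? (adjacent? G) w) when does (head w ≟ last w)
           ≡⟨ when-∧ _ (does (linked? (adjacent? G) w)) _ ⟩
         -1^ pairing G (lookup s) w when does (isClosedWalk? G w)
           ≡⟨ cong (λ p → -1^ p when does (isClosedWalk? G w)) (·-parityVector G s w) ⟨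
         -1^ (s · parityVector G w) when does (isClosedWalk? G w)
           -- Read from right to left: the sign of one closed walk is spread over all `z`, with a
           -- single nonzero term at its parity vector.
           ≡⟨ sumOver-Z-ev-point G 2∣ℓ w (isClosedWalk? G w) (λ z → -1^ (s · z)) ⟨
         sumOver (Z-ev G) (λ z → -1^ (s · z) when contributes w z) ∎) ⟩
  sumOver walks (λ w → sumOver (Z-ev G) λ z → -1^ (s · z) when contributes w z)
    ≡⟨ sumOver-comm walks (Z-ev G) _ ⟩
  sumOver (Z-ev G) (λ z → sumOver walks λ w → -1^ (s · z) when contributes w z)
    -- For fixed `z` the sign no longer depends on `w`, so the inner sum counts the closed walks
    -- with parity vector `z`.
    ≡⟨ sumOver-cong (Z-ev G) (λ z → length-filter-* _ walks (-1^ (s · z))) ⟨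
  sumOver (Z-ev G) (λ z → + (N G ℓ z) * (-1^ (s · z))) ∎
  where
  walks = tuples (allFin (SimpleGraph.order G)) (suc ℓ)

  contributes : Vec (Fin (SimpleGraph.order G)) (suc ℓ) → 𝔽₂^ (SimpleGraph.size G) → Bool
  contributes w z = does (isClosedWalk? G w) ∧ does (Vec.≡-dec ℙ._≟_ (parityVector G w) z)
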